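{- Let $(M,\in)$ be a countable model of ZFA, and let $D$ be its double-edge graph: the graph with vertex set $M$ whose edges are all pairs $\{x,y\}$ (allowing $x=y$) such that $M\models x\in y$ and $M\models y\in x$. Then, for every finite connected loopy graph $\Gamma$, $D$ has infinitely many connected components isomorphic to $\Gamma$. Moreover, $D$ has at least one infinite connected component.
   Context: ZFA denotes the first-order theory obtained from ZFC (all objects being sets) by deleting the Axiom of Foundation and replacing it by the Anti-Foundation Axiom AFA. AFA states that every flat system of equations has a unique solution. A flat system of equations consists of a set $X$ of indeterminates, a set $A$ of sets called atoms (disjoint from $X$), and, for each $x\in X$, an equation $x=S_x$ with $S_x\subseteq X\cup A$ (the family $(S_x)_{x\in X}$ being itself a set). A solution is an assignment of sets to the indeterminates making all equations true, i.e. a function $s$ with domain $X$ such that $s(x)=\{s(y):y\in S_x\cap X\}\cup(S_x\cap A)$ for all $x\in X$. A loopy graph is an undirected graph without multiple edges in which loops are allowed, i.e. a set with a symmetric (not necessarily irreflexive) binary adjacency relation. Connected graphs are taken to be nonempty. Connected components are regarded as loopy graphs with the induced adjacency relation (loops included), and isomorphisms preserve and reflect both edges and loops. -}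

module Defs where

open import Data.Empty using (⊥)
open import Data.Fin using (Fin; suc; lift; _↑ʳ_)
open import Data.Fin.Patterns
open import Data.Nat using (ℕ; zero; suc; _+_)
open import Data.Product using (Σ; Σ-syntax; ∃-syntax; _×_; _,_; proj₁; swap)
open import Data.Refinement using (Refinement-syntax; value)
open import Data.Sum using (_⊎_)
open import Data.Vec using (Vec; []; _∷_; lookup)
open import Data.Vec.Functional using () renaming (_∷_ to _◂_)
open import Function.Bundles using (Injection; Inverse; _↔_; _↣_; _⇔_)
open import Level using (0ℓ)
open import Relation.Binary.Bundles using (Setoid)
open import Relation.Binary.Core using (Rel)
open import Relation.Binary.Definitions using (Symmetric)
open import Relation.Binary.Construct.Closure.ReflexiveTransitive
  using (Star; ε; _◅◅_; reverse)
import Relation.Binary.Construct.On as On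
open import Relation.Binary.PropositionalEquality using (_≡_; setoid)

private variable
  m n : ℕ

-- First-order formulas over {∈, =}, with free variables in Fin n.
-- Variables are de Bruijn indices: 0F is the innermost bound variable.

infix  7 _∈̇_ _≐_ _⊆̇_
infix  6 ¬̇_
infixr 5 _∧̇_
infixr 4 _∨̇_
infixr 3 _⇒̇_
infix  3 _⇔̇_
infixr 2 ∀̇_ ∃̇_ ∃!̇_
infix  8 _≐｛_,_｝ _≐⟨_,_⟩ ⟨_,_⟩∈̇_

data Formula (n : ℕ) : Set where
  _∈̇_ _≐_           : Fin n → Fin n → Formula n
  ⊥̇                 : Formula n
  _∧̇_ _∨̇_ _⇒̇_       : Formula n → Formula n → Formula n
  ∀̇_ ∃̇_             : Formula (suc n) → Formula n

Sentence : Set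
Sentence = Formula 0

Theory : Set₁
Theory = Sentence → Set

rename : (Fin m → Fin n) → Formula m → Formula n
rename r (i ∈̇ j) = r i ∈̇ r j
rename r (i ≐ j) = r i ≐ r j
rename r ⊥̇       = ⊥̇
rename r (φ ∧̇ ψ) = rename r φ ∧̇ rename r ψ
rename r (φ ∨̇ ψ) = rename r φ ∨̇ rename r ψ
rename r (φ ⇒̇ ψ) = rename r φ ⇒̇ rename r ψ
rename r (∀̇ φ)   = ∀̇ rename (lift 1 r) φ
rename r (∃̇ φ)   = ∃̇ rename (lift 1 r) φ

universalClosure : Formula n → Sentence
universalClosure {zero}  φ = φ
universalClosure {suc n} φ = universalClosure (∀̇ φ)

¬̇_ : Formula n → Formula n
¬̇ φ = φ ⇒̇ ⊥̇

_⇔̇_ : Formula n → Formula n → Formula n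
φ ⇔̇ ψ = (φ ⇒̇ ψ) ∧̇ (ψ ⇒̇ φ)

-- ∃x (φ(x) ∧ ∀y (φ(y) → y = x))
∃!̇_ : Formula (suc n) → Formula n
∃!̇ φ = ∃̇ (φ ∧̇ (∀̇ rename (0F ◂ (2 ↑ʳ_)) φ ⇒̇ 0F ≐ 1F))

∀∈ ∃∈ : Fin n → Formula (suc n) → Formula n
∀∈ a φ = ∀̇ 0F ∈̇ suc a ⇒̇ φ
∃∈ a φ = ∃̇ 0F ∈̇ suc a ∧̇ φ

record Structure : Set₁ where
  field
    Carrier : Set
    _∈ᴹ_    : Rel Carrier 0ℓ

open Structure public using (Carrier)

⟦_⟧ : Formula n → (M : Structure) → Vec (Carrier M) n → Set
⟦ i ∈̇ j ⟧ M ρ = Structure._∈ᴹ_ M (lookup ρ i) (lookup ρ j)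
⟦ i ≐ j ⟧ M ρ = lookup ρ i ≡ lookup ρ j
⟦ ⊥̇ ⟧     M ρ = ⊥
⟦ φ ∧̇ ψ ⟧ M ρ = ⟦ φ ⟧ M ρ × ⟦ ψ ⟧ M ρ
⟦ φ ∨̇ ψ ⟧ M ρ = ⟦ φ ⟧ M ρ ⊎ ⟦ ψ ⟧ M ρ
⟦ φ ⇒̇ ψ ⟧ M ρ = ⟦ φ ⟧ M ρ → ⟦ ψ ⟧ M ρ
⟦ ∀̇ φ ⟧   M ρ = (x : Carrier M) → ⟦ φ ⟧ M (x ∷ ρ)
⟦ ∃̇ φ ⟧   M ρ = Σ[ x ∈ Carrier M ] ⟦ φ ⟧ M (x ∷ ρ)

infix 1 _⊨_ _⊨ᵀ_

_⊨_ : Structure → Sentence → Set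
M ⊨ φ = ⟦ φ ⟧ M []

_⊨ᵀ_ : Structure → Theory → Set
M ⊨ᵀ T = ∀ φ → T φ → M ⊨ φ

Countable : Structure → Set
Countable M = Carrier M ↣ ℕ

_⊆̇_ : Fin n → Fin n → Formula n
x ⊆̇ y = ∀∈ x (0F ∈̇ suc y)

isEmpty : Fin n → Formula n
isEmpty x = ∀̇ ¬̇ (0F ∈̇ suc x)

disjoint : Fin n → Fin n → Formula n
disjoint x y = ∀̇ ¬̇ (0F ∈̇ suc x ∧̇ 0F ∈̇ suc y)

-- y = x ∪ {x}
isSuccessorOf : Fin n → Fin n → Formula n
isSuccessorOf y x = ∀̇ 0F ∈̇ suc y ⇔̇ (0F ∈̇ suc x ∨̇ 0F ≐ suc x)

_≐｛_,_｝ : Fin n → Fin n → Fin n → Formula n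
z ≐｛ x , y ｝ = ∀̇ 0F ∈̇ suc z ⇔̇ (0F ≐ suc x ∨̇ 0F ≐ suc y)

-- Kuratowski pairs: p = {{x, x}, {x, y}}
_≐⟨_,_⟩ : Fin n → Fin n → Fin n → Formula n
p ≐⟨ x , y ⟩ =
  ∀̇ 0F ∈̇ suc p ⇔̇ (0F ≐｛ suc x , suc x ｝ ∨̇ 0F ≐｛ suc x , suc y ｝)

⟨_,_⟩∈̇_ : Fin n → Fin n → Fin n → Formula n
⟨ x , y ⟩∈̇ f = ∃∈ f (0F ≐⟨ suc x , suc y ⟩)

-- f is a set of ordered pairs and a function with domain exactly X.
isFunctionOn : Fin n → Fin n → Formula n
isFunctionOn f X =
    ∀∈ f (∃∈ (suc X) (∃̇ 2F ≐⟨ 1F , 0F ⟩))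
  ∧̇ ∀∈ X (∃!̇ ⟨ 1F , 0F ⟩∈̇ suc (suc f))

-- The system x = S(x) for x ∈ X, with atoms A.
isFlatSystem : Fin n → Fin n → Fin n → Formula n
isFlatSystem X A S =
    disjoint X A
  ∧̇ isFunctionOn S X
  -- for x ∈ X and u = S(x), every z ∈ u lies in X ∪ A
  ∧̇ ∀∈ X (∀̇ ⟨ 1F , 0F ⟩∈̇ (2 ↑ʳ S) ⇒̇
      ∀∈ 0F (0F ∈̇ (3 ↑ʳ X) ∨̇ 0F ∈̇ (3 ↑ʳ A)))

isSolution : Fin n → Fin n → Fin n → Fin n → Formula n
isSolution s X A S =
    isFunctionOn s X
  -- for x ∈ X, u = S(x) and v = s(x):
  --   z ∈ v ⇔ (∃ y ∈ u. y ∈ X ∧ z = s(y)) ∨ (z ∈ u ∧ z ∈ A)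
  ∧̇ ∀∈ X (∀̇ ∀̇
      ⟨ 2F , 1F ⟩∈̇ (3 ↑ʳ S) ∧̇ ⟨ 2F , 0F ⟩∈̇ (3 ↑ʳ s) ⇒̇
      (∀̇ 0F ∈̇ 1F ⇔̇
        (  ∃∈ 2F (0F ∈̇ (5 ↑ʳ X) ∧̇ ⟨ 0F , 1F ⟩∈̇ (5 ↑ʳ s))
        ∨̇ 0F ∈̇ 2F ∧̇ 0F ∈̇ (4 ↑ʳ A))))

extensionality pairing union powerSet infinity choice antiFoundation : Sentence

extensionality = ∀̇ ∀̇ (∀̇ 0F ∈̇ 1F ⇔̇ 0F ∈̇ 2F) ⇒̇ 0F ≐ 1F

pairing = ∀̇ ∀̇ ∃̇ 0F ≐｛ 1F , 2F ｝

union = ∀̇ ∃̇ ∀̇ 0F ∈̇ 1F ⇔̇ ∃∈ 2F (1F ∈̇ 0F)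

powerSet = ∀̇ ∃̇ ∀̇ 0F ∈̇ 1F ⇔̇ 0F ⊆̇ 2F

infinity = ∃̇ ∃∈ 0F (isEmpty 0F) ∧̇ ∀∈ 0F (∃∈ 1F (isSuccessorOf 0F 1F))

-- Every set F of nonempty, pairwise disjoint sets has a transversal.
choice = ∀̇
  ∀∈ 0F (∃̇ 0F ∈̇ 1F) ∧̇
  ∀∈ 0F (∀∈ 1F ((∃̇ 0F ∈̇ 1F ∧̇ 0F ∈̇ 2F) ⇒̇ 0F ≐ 1F)) ⇒̇
  (∃̇ ∀∈ 1F (∃!̇ 0F ∈̇ 1F ∧̇ 0F ∈̇ 2F))

-- ∀ X A S. (X, A, S) is a flat system → ∃! s. s is a solution of it
antiFoundation =
  ∀̇ ∀̇ ∀̇ isFlatSystem 2F 1F 0F ⇒̇ (∃!̇ isSolution 0F 3F 2F 1F)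

-- For φ(x, p⃗):  ∀ p⃗ a. ∃ b. ∀ x. x ∈ b ⇔ x ∈ a ∧ φ(x, p⃗)
separation : Formula (1 + n) → Sentence
separation φ = universalClosure
  (∀̇ ∃̇ ∀̇ 0F ∈̇ 1F ⇔̇ (0F ∈̇ 2F ∧̇ rename (0F ◂ (3 ↑ʳ_)) φ))

-- For φ(x, y, p⃗):  ∀ p⃗ a.
--   (∀ x ∈ a. ∀ y y'. φ(x, y, p⃗) ∧ φ(x, y', p⃗) → y = y') →
--   ∃ b. ∀ y. y ∈ b ⇔ ∃ x ∈ a. φ(x, y, p⃗)
replacement : Formula (2 + n) → Sentence
replacement φ = universalClosure
  (∀̇ ∀∈ 0F (∀̇ ∀̇
        rename (2F ◂ 1F ◂ (4 ↑ʳ_)) φ ∧̇ rename (2F ◂ 0F ◂ (4 ↑ʳ_)) φ ⇒̇ 1F ≐ 0F)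
     ⇒̇ (∃̇ ∀̇ 0F ∈̇ 1F ⇔̇ ∃∈ 2F (rename (0F ◂ 1F ◂ (4 ↑ʳ_)) φ)))

data ZFA : Theory where
  ext  : ZFA extensionality
  pair : ZFA pairing
  un   : ZFA union
  pow  : ZFA powerSet
  inf  : ZFA infinity
  sep  : (φ : Formula (1 + n)) → ZFA (separation φ)
  rep  : (φ : Formula (2 + n)) → ZFA (replacement φ)
  ac   : ZFA choice
  afa  : ZFA antiFoundation

record LoopyGraph : Set₁ where
  field
    Vertex : Set
    Adj    : Rel Vertex 0ℓ
    sym    : Symmetric Adj

open LoopyGraph public using (Vertex; Adj)

record _≅_ (G H : LoopyGraph) : Set where
  field
    vertices : Vertex G ↔ Vertex H
    edges    : ∀ x y → Adj G x y ⇔ Adj H (Inverse.to vertices x) (Inverse.to vertices y)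

Finite : LoopyGraph → Set
Finite G = ∃[ n ] (Vertex G ↔ Fin n)

-- Existence of a walk.
Linked : (G : LoopyGraph) → Rel (Vertex G) 0ℓ
Linked G = Star (Adj G)

Connected : LoopyGraph → Set
Connected G = Vertex G × (∀ x y → Linked G x y)

-- The membership proof in a refinement type is irrelevant, so vertices of an
-- induced subgraph are equal as soon as they are equal in G.
induced : (G : LoopyGraph) → (Vertex G → Set) → LoopyGraph
induced G P = record
  { Vertex = [ x ∈ Vertex G ∣ P x ]
  ; Adj    = λ x y → Adj G (value x) (value y)
  ; sym    = LoopyGraph.sym G
  }

component : (G : LoopyGraph) → Vertex G → LoopyGraph
component G x = induced G (Linked G x)

-- The set of connected components, each given by any of its vertices.
Components : LoopyGraph → Setoid 0ℓ 0ℓ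
Components G = record
  { Carrier       = Vertex G
  ; _≈_           = Linked G
  ; isEquivalence = record
    { refl  = ε
    ; sym   = reverse (LoopyGraph.sym G)
    ; trans = _◅◅_
    }
  }

ComponentsIsomorphicTo : LoopyGraph → LoopyGraph → Setoid 0ℓ 0ℓ
ComponentsIsomorphicTo Γ G =
  On.setoid {B = Σ[ x ∈ Vertex G ] component G x ≅ Γ} (Components G) proj₁

-- An infinite sequence of pairwise inequivalent elements. This implies that S
-- is not finite, and by excluded middle is equivalent to it for the quotients
-- of countable sets to which it is applied.
Infinite : Setoid 0ℓ 0ℓ → Set
Infinite S = Injection (setoid ℕ) S

doubleEdgeGraph : Structure → LoopyGraph
doubleEdgeGraph M = record
  { Vertex = Carrier M
  ; Adj    = λ x y → (x ∈ᴹ y) × (y ∈ᴹ x)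
  ; sym    = swap
  }
  where open Structure M

{-# OPTIONS --safe #-}

-- A vertex i gets the label pᵢ = {∅, {{v}}}, where v is a nonempty von Neumann
-- numeral depending on i, and the indeterminate of the vertex i is pᵢ itself.
-- AFA applied to the equations pᵢ = {pⱼ : j adjacent to i} ∪ pᵢ yields sets
-- sᵢ = {sⱼ : j adjacent to i} ∪ pᵢ.  Every sⱼ contains ∅, which is neither in
-- an element z of a label nor in an element of such a z.  Hence no sⱼ is an
-- element of a label, so the label can be recovered from sᵢ, and no sⱼ is an
-- element of an element of a label, so the D-neighbours of sᵢ are exactly the
-- sⱼ with j adjacent to i.
--
-- A finite graph thus becomes a component of D, and disjoint ranges of numerals
-- give different components.  For an infinite component, take the complete
-- graph on all labels formed from a set W as in the axiom of infinity.

module Submission where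

open import Defs
open import Axiom.ExcludedMiddle using (ExcludedMiddle)
open import Data.Empty using (⊥-elim; ⊥-elim-irr)
open import Data.Fin using (Fin; zero; suc; toℕ)
open import Data.Fin.Patterns
open import Data.Fin.Properties using (toℕ<n; toℕ-injective)
open import Data.Irrelevant using ([_])
open import Data.Nat using (ℕ; zero; suc; _+_; _*_; _≤_; _<_; s≤s)
open import Data.Nat.DivMod using (_%_; m<n⇒m%n≡m; [m+kn]%n≡m%n)
open import Data.Nat.Properties
  using (≤-refl; m≤n⇒m<n∨m≡n; <-cmp; <⇒≤; *-cancelʳ-≡; +-cancelˡ-≡)
open import Data.Product using (∃-syntax; _×_; _,_; proj₁; proj₂; map₂)
open import Data.Refinement using (value; _,_; value-injective)
open import Data.Sum using (_⊎_; inj₁; inj₂; [_,_]′)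
open import Data.Unit using (⊤; tt)
open import Function using (_∘_; id)
open import Function.Bundles using (_↔_; Inverse; mk↔ₛ′; mk⇔; mk↣)
open import Level using (0ℓ)
open import Relation.Binary.Construct.Closure.ReflexiveTransitive
  using (ε; _◅_; gmap)
open import Relation.Binary.Definitions using (tri<; tri≈; tri>)
open import Relation.Binary.PropositionalEquality
  using (_≡_; refl; sym; trans; cong; subst; subst₂; setoid)
open import Relation.Nullary using (¬_; yes; no)

infix 1 _⟺_

_⟺_ : Set → Set → Set
A ⟺ B = (A → B) × (B → A)

-- Uniqueness of division with remainder by `n`. Vertex `i` of copy `k` of an `n`-vertex graph will
-- use the number `i + k * n`, so different copies share no label.
i+kn-injective : ∀ {n} (i j : Fin n) k l →
                 toℕ i + k * n ≡ toℕ j + l * n → i ≡ j × k ≡ l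
i+kn-injective {n@(suc _)} i j k l eq = toℕ-injective i≡j , k≡l
  where
  remainder : ∀ (i : Fin n) k → (toℕ i + k * n) % n ≡ toℕ i
  remainder i k = trans ([m+kn]%n≡m%n (toℕ i) k n) (m<n⇒m%n≡m (toℕ<n i))

  i≡j : toℕ i ≡ toℕ j
  i≡j = trans (sym (remainder i k)) (trans (cong (_% n) eq) (remainder j l))

  k≡l : k ≡ l
  k≡l = *-cancelʳ-≡ k l n
    (+-cancelˡ-≡ (toℕ i) _ _ (trans eq (cong (_+ l * n) (sym i≡j))))

module Model (em : ExcludedMiddle 0ℓ) (M : Structure) (zfa : M ⊨ᵀ ZFA) where

  open Structure M using (_∈ᴹ_)

  infix 4 _∈_ _∉_
  infixl 6 _∪_

  V : Set
  V = Carrier M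

  _∈_ _∉_ : V → V → Set
  _∈_ = _∈ᴹ_
  x ∉ y = ¬ (x ∈ y)

  D : LoopyGraph
  D = doubleEdgeGraph M

  -- Sets in M

  extensional : ∀ {x y} → (∀ z → z ∈ x ⟺ z ∈ y) → x ≡ y
  extensional {x} {y} h = zfa _ ext y x h

  abstract
    ｛_⨾_｝ : V → V → V
    ｛ x ⨾ y ｝ = proj₁ (zfa _ pair y x)

    ∈-pair : ∀ {x y} z → z ∈ ｛ x ⨾ y ｝ ⟺ (z ≡ x ⊎ z ≡ y)
    ∈-pair {x} {y} = proj₂ (zfa _ pair y x)

  ｛_｝ : V → V
  ｛ x ｝ = ｛ x ⨾ x ｝

  x∈｛x｝ : ∀ {x} → x ∈ ｛ x ｝
  x∈｛x｝ = proj₂ (∈-pair _) (inj₁ refl)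

  ∈-singleton : ∀ {x z} → z ∈ ｛ x ｝ → z ≡ x
  ∈-singleton = [ id , id ]′ ∘ proj₁ (∈-pair _)

  singleton-injective : ∀ {x y} → ｛ x ｝ ≡ ｛ y ｝ → x ≡ y
  singleton-injective {x} eq = ∈-singleton (subst (x ∈_) eq x∈｛x｝)

  abstract
    ⋃ : V → V
    ⋃ a = proj₁ (zfa _ un a)

    ∈-⋃ : ∀ {a} z → z ∈ ⋃ a ⟺ (∃[ y ] y ∈ a × z ∈ y)
    ∈-⋃ {a} = proj₂ (zfa _ un a)

  _∪_ : V → V → V
  a ∪ b = ⋃ ｛ a ⨾ b ｝

  ∈-∪ : ∀ {a b} z → z ∈ a ∪ b ⟺ (z ∈ a ⊎ z ∈ b)
  ∈-∪ {a} {b} z = to , from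
    where
    to : z ∈ a ∪ b → z ∈ a ⊎ z ∈ b
    to h with proj₁ (∈-⋃ z) h
    ... | y , y∈ , z∈y with proj₁ (∈-pair y) y∈
    ...   | inj₁ refl = inj₁ z∈y
    ...   | inj₂ refl = inj₂ z∈y

    from : z ∈ a ⊎ z ∈ b → z ∈ a ∪ b
    from (inj₁ z∈a) = proj₂ (∈-⋃ z) (a , proj₂ (∈-pair a) (inj₁ refl) , z∈a)
    from (inj₂ z∈b) = proj₂ (∈-⋃ z) (b , proj₂ (∈-pair b) (inj₂ refl) , z∈b)

  abstract
    𝒫 : V → V
    𝒫 a = proj₁ (zfa _ pow a)

    ∈-𝒫 : ∀ {a} z → z ∈ 𝒫 a ⟺ (∀ y → y ∈ z → y ∈ a)
    ∈-𝒫 {a} = proj₂ (zfa _ pow a)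

  ｛｝∈𝒫 : ∀ {a x y} → x ∈ a → y ∈ a → ｛ x ⨾ y ｝ ∈ 𝒫 a
  ｛｝∈𝒫 {a} x∈a y∈a = proj₂ (∈-𝒫 _) λ z z∈ →
    [ (λ eq → subst (_∈ a) (sym eq) x∈a) , (λ eq → subst (_∈ a) (sym eq) y∈a) ]′
      (proj₁ (∈-pair z) z∈)

  -- The meaning of the formula `p ≐⟨ x , y ⟩` in `M`, so that instances of the axioms mention
  -- exactly this type.
  IsPair : V → V → V → Set
  IsPair p x y = ∀ z → z ∈ p ⟺
    ((∀ w → w ∈ z ⟺ (w ≡ x ⊎ w ≡ x)) ⊎ (∀ w → w ∈ z ⟺ (w ≡ x ⊎ w ≡ y)))

  ⟨_,_⟩ : V → V → V
  ⟨ x , y ⟩ = ｛ ｛ x ｝ ⨾ ｛ x ⨾ y ｝ ｝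

  isPair-⟨,⟩ : ∀ x y → IsPair ⟨ x , y ⟩ x y
  isPair-⟨,⟩ x y z = to , from
    where
    to : z ∈ ⟨ x , y ⟩ → _
    to z∈ with proj₁ (∈-pair z) z∈
    ... | inj₁ refl = inj₁ ∈-pair
    ... | inj₂ refl = inj₂ ∈-pair

    ≡pair : ∀ {x′ y′} → (∀ w → w ∈ z ⟺ (w ≡ x′ ⊎ w ≡ y′)) → z ≡ ｛ x′ ⨾ y′ ｝
    ≡pair h = extensional λ w →
      proj₂ (∈-pair w) ∘ proj₁ (h w) , proj₂ (h w) ∘ proj₁ (∈-pair w)

    from : _ → z ∈ ⟨ x , y ⟩
    from = proj₂ (∈-pair z) ∘ [ inj₁ ∘ ≡pair , inj₂ ∘ ≡pair ]′

  isPair-unique : ∀ {p q x y} → IsPair p x y → IsPair q x y → p ≡ q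
  isPair-unique hp hq = extensional λ z →
    proj₂ (hq z) ∘ proj₁ (hp z) , proj₂ (hp z) ∘ proj₁ (hq z)

  ≡⟨,⟩ : ∀ {p x y} → IsPair p x y → p ≡ ⟨ x , y ⟩
  ≡⟨,⟩ h = isPair-unique h (isPair-⟨,⟩ _ _)

  pair-injectiveʳ : ∀ {x y z} → ｛ x ⨾ y ｝ ≡ ｛ x ⨾ z ｝ → y ≡ z
  pair-injectiveʳ {x} {y} {z} eq
    with proj₁ (∈-pair y) (subst (y ∈_) eq (proj₂ (∈-pair y) (inj₂ refl)))
       | proj₁ (∈-pair z) (subst (z ∈_) (sym eq) (proj₂ (∈-pair z) (inj₂ refl)))
  ... | inj₂ y≡z | _        = y≡z
  ... | inj₁ _   | inj₂ z≡y = sym z≡y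
  ... | inj₁ y≡x | inj₁ z≡x = trans y≡x (sym z≡x)

  ⟨,⟩-injective : ∀ {x y x′ y′} → ⟨ x , y ⟩ ≡ ⟨ x′ , y′ ⟩ → x ≡ x′ × y ≡ y′
  ⟨,⟩-injective {x} {y} {x′} {y′} eq = x≡x′ , y≡y′ x≡x′ eq
    where
    x≡x′ : x ≡ x′
    x≡x′ with proj₁ (∈-pair ｛ x ｝) (subst (｛ x ｝ ∈_) eq (proj₂ (∈-pair _) (inj₁ refl)))
    ... | inj₁ h = ∈-singleton (subst (x ∈_) h x∈｛x｝)
    ... | inj₂ h = sym (∈-singleton (subst (x′ ∈_) (sym h) (proj₂ (∈-pair x′) (inj₁ refl))))

    y≡y′ : x ≡ x′ → ⟨ x , y ⟩ ≡ ⟨ x′ , y′ ⟩ → y ≡ y′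
    -- With equal first components, the outer pairs share `｛ x ｝` and the inner ones share `x`.
    y≡y′ refl = pair-injectiveʳ ∘ pair-injectiveʳ

  isPair-injective : ∀ {p x y x′ y′} → IsPair p x y → IsPair p x′ y′ → x ≡ x′ × y ≡ y′
  isPair-injective h h′ = ⟨,⟩-injective (trans (sym (≡⟨,⟩ h)) (≡⟨,⟩ h′))

  -- Numerals and labels

  abstract
    W : V
    W = proj₁ (zfa _ inf)

    ∅ : V
    ∅ = proj₁ (proj₁ (proj₂ (zfa _ inf)))

    ∅∈W : ∅ ∈ W
    ∅∈W = proj₁ (proj₂ (proj₁ (proj₂ (zfa _ inf))))

    ∉∅ : ∀ {z} → z ∉ ∅
    ∉∅ {z} = proj₂ (proj₂ (proj₁ (proj₂ (zfa _ inf)))) z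

    W-closed : ∀ {x} → x ∈ W → x ∪ ｛ x ｝ ∈ W
    W-closed {x} x∈W with proj₂ (proj₂ (zfa _ inf)) x x∈W
    ... | y , y∈W , h = subst (_∈ W) (extensional λ z →
            (λ z∈y → proj₂ (∈-∪ z) ([ inj₁ , inj₂ ∘ proj₂ (∈-pair z) ∘ inj₁ ]′ (proj₁ (h z) z∈y)))
          , (λ z∈ → proj₂ (h z) ([ inj₁ , inj₂ ∘ ∈-singleton ]′ (proj₁ (∈-∪ z) z∈)))) y∈W

  -- numeral m is the von Neumann numeral of m + 1.
  numeral : ℕ → V
  numeral zero    = ｛ ∅ ｝
  numeral (suc m) = numeral m ∪ ｛ numeral m ｝

  -- The reason for starting at 1: each numeral differs from `∅`, so `∅ ∉ ｛ numeral m ｝`, as labels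
  -- require.
  ∅∈numeral : ∀ m → ∅ ∈ numeral m
  ∅∈numeral zero    = x∈｛x｝
  ∅∈numeral (suc m) = proj₂ (∈-∪ ∅) (inj₁ (∅∈numeral m))

  numeral∈W : ∀ m → numeral m ∈ W
  numeral∈W zero    = subst (_∈ W) (extensional λ z →
      [ ⊥-elim ∘ ∉∅ , id ]′ ∘ proj₁ (∈-∪ z) , proj₂ (∈-∪ z) ∘ inj₂) (W-closed ∅∈W)
  numeral∈W (suc m) = W-closed (numeral∈W m)

  numeral-∈ : ∀ {i j} → i < j → numeral i ∈ numeral j
  numeral-∈ {i} {suc j} (s≤s i≤j) with m≤n⇒m<n∨m≡n i≤j
  ... | inj₁ i<j  = proj₂ (∈-∪ _) (inj₁ (numeral-∈ i<j))
  ... | inj₂ refl = proj₂ (∈-∪ _) (inj₂ x∈｛x｝)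

  -- Without Foundation even `x ∉ x` needs a proof. In the induction on `j`, if
  -- `numeral i ≡ numeral j` with `j < i`, then `numeral j ∈ numeral j`, against the induction
  -- hypothesis.
  numeral-∉ : ∀ {i j} → j ≤ i → numeral i ∉ numeral j
  numeral-∉ {i} {zero}  _   h = ∉∅ (subst (∅ ∈_) (∈-singleton h) (∅∈numeral i))
  numeral-∉ {i} {suc j} j<i h with proj₁ (∈-∪ _) h
  ... | inj₁ i∈j = numeral-∉ (<⇒≤ j<i) i∈j
  ... | inj₂ i∈  = numeral-∉ {j} ≤-refl (subst (numeral j ∈_) (∈-singleton i∈) (numeral-∈ j<i))

  numeral-injective : ∀ i j → numeral i ≡ numeral j → i ≡ j
  numeral-injective i j eq with <-cmp i j
  ... | tri< i<j _ _ = ⊥-elim (numeral-∉ {i} ≤-refl (subst (numeral i ∈_) (sym eq) (numeral-∈ i<j)))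
  ... | tri≈ _ i≡j _ = i≡j
  ... | tri> _ _ j<i = ⊥-elim (numeral-∉ {j} ≤-refl (subst (numeral j ∈_) eq (numeral-∈ j<i)))

  -- Stated without the external numbers `m`, so that it is a formula of set theory and separation
  -- can collect labels inside `M`.
  IsLabel : V → Set
  IsLabel p = ∅ ∈ p × (∀ z → z ∈ p → ∅ ∉ z × (∀ y → y ∈ z → ∅ ∉ y))

  atom label : ℕ → V
  atom m  = ｛ ｛ numeral m ｝ ｝
  label m = ｛ ∅ ⨾ atom m ｝

  atom∈label : ∀ m → atom m ∈ label m
  atom∈label m = proj₂ (∈-pair _) (inj₂ refl)

  label-isLabel : ∀ m → IsLabel (label m)
  label-isLabel m = proj₂ (∈-pair ∅) (inj₁ refl) , λ z → elements ∘ proj₁ (∈-pair z)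
    where
    ∅∉｛numeral｝ : ∅ ∉ ｛ numeral m ｝
    ∅∉｛numeral｝ h = ∉∅ (subst (∅ ∈_) (sym (∈-singleton h)) (∅∈numeral m))

    elements : ∀ {z} → z ≡ ∅ ⊎ z ≡ atom m → ∅ ∉ z × (∀ y → y ∈ z → ∅ ∉ y)
    elements (inj₁ refl) = ∉∅ , λ _ y∈∅ → ⊥-elim (∉∅ y∈∅)
    elements (inj₂ refl) =
        (λ h → ∉∅ (subst (numeral m ∈_) (sym (∈-singleton h)) x∈｛x｝))
      , (λ y y∈ → subst (∅ ∉_) (sym (∈-singleton y∈)) ∅∉｛numeral｝)

  atom∈label⇒≡ : ∀ {m n} → atom m ∈ label n → m ≡ n
  atom∈label⇒≡ {m} {n} h with proj₁ (∈-pair _) h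
  ... | inj₁ eq = ⊥-elim (∉∅ (subst (｛ numeral m ｝ ∈_) eq x∈｛x｝))
  ... | inj₂ eq = numeral-injective m n (singleton-injective (singleton-injective eq))

  -- Bounds the labels by one set of `M`, as separation needs; each layer of braces around a numeral
  -- costs one power set.
  label∈𝒫³W : ∀ m → label m ∈ 𝒫 (𝒫 (𝒫 W))
  label∈𝒫³W m = ｛｝∈𝒫 (proj₂ (∈-𝒫 ∅) (λ _ → ⊥-elim ∘ ∉∅))
    (｛｝∈𝒫 ｛numeral｝∈ ｛numeral｝∈)
    where
    ｛numeral｝∈ : ｛ numeral m ｝ ∈ 𝒫 W
    ｛numeral｝∈ = ｛｝∈𝒫 (numeral∈W m) (numeral∈W m)

  -- Decorations of labelled graphs

  IsDecoration : {I : Set} → (I → V) → (I → I → Set) → (I → V) → Set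
  IsDecoration p N s = ∀ i z → z ∈ s i ⟺ ((∃[ j ] N i j × z ≡ s j) ⊎ z ∈ p i)

  -- `I` and `N` live outside `M`; only `X`, `S` and each `u i` are sets of `M`. `u-cong` makes `S`
  -- a function even if several indices share a label.
  module FlatSystem
      {I : Set} (p : I → V) (N : I → I → Set) (u : I → V) (X S : V)
      (isLabel : ∀ i → IsLabel (p i))
      (∈X : ∀ z → z ∈ X ⟺ (∃[ i ] z ≡ p i))
      (∈u : ∀ i z → z ∈ u i ⟺ ((∃[ j ] N i j × z ≡ p j) ⊎ z ∈ p i))
      (u-cong : ∀ i j → p i ≡ p j → u i ≡ u j)
      (∈S : ∀ q → q ∈ S ⟺ (∃[ i ] IsPair q (p i) (u i)))
      where

    A : V
    A = ⋃ X

    p∈X : ∀ i → p i ∈ X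
    p∈X i = proj₂ (∈X _) (i , refl)

    -- Every label contains `∅`, and no element of a label does. This keeps the indeterminates apart
    -- from the atoms.
    p∉p : ∀ {i j} → p i ∉ p j
    p∉p {i} {j} h = proj₁ (proj₂ (isLabel j) (p i) h) (proj₁ (isLabel i))

    p⊆A : ∀ {i z} → z ∈ p i → z ∈ A
    p⊆A {i} z∈ = proj₂ (∈-⋃ _) (p i , p∈X i , z∈)

    X∩A=∅ : ∀ z → ¬ (z ∈ X × z ∈ A)
    X∩A=∅ z (z∈X , z∈A) with proj₁ (∈X z) z∈X | proj₁ (∈-⋃ z) z∈A
    ... | i , refl | y , y∈X , z∈y with proj₁ (∈X y) y∈X
    ...   | j , refl = p∉p z∈y

    u-unique : ∀ {q i v} → q ∈ S → IsPair q (p i) v → v ≡ u i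
    u-unique {q} {i} q∈S h with proj₁ (∈S q) q∈S
    ... | j , h′ with isPair-injective h h′
    ...   | pi≡pj , v≡uj = trans v≡uj (sym (u-cong i j pi≡pj))

    pu∈S : ∀ i → ∃[ q ] q ∈ S × IsPair q (p i) (u i)
    pu∈S i = _ , proj₂ (∈S _) (i , isPair-⟨,⟩ _ _) , isPair-⟨,⟩ _ _

    solution = zfa _ afa X A S
      ( X∩A=∅
      , ( (λ q q∈S → let i , h = proj₁ (∈S q) q∈S in p i , p∈X i , u i , h)
        , λ x x∈X → let i , x≡ = proj₁ (∈X x) x∈X in
            u i , subst (λ x → ∃[ q ] q ∈ S × IsPair q x (u i)) (sym x≡) (pu∈S i)
          , λ { v (q , q∈S , h) → u-unique q∈S (subst (λ x → IsPair q x v) x≡ h) } )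
      , λ { x x∈X v (q , q∈S , h) z z∈v →
            let i , x≡ = proj₁ (∈X x) x∈X
                v≡u = u-unique q∈S (subst (λ x → IsPair q x v) x≡ h)
            in [ (λ { (j , _ , eq) → inj₁ (proj₂ (∈X z) (j , eq)) }) , inj₂ ∘ p⊆A ]′
                 (proj₁ (∈u i z) (subst (z ∈_) v≡u z∈v)) } )

    f : V
    f = proj₁ solution

    f-functional = proj₂ (proj₁ (proj₁ (proj₂ solution)))
    f-equations  = proj₂ (proj₁ (proj₂ solution))

    s : I → V
    s i = proj₁ (f-functional (p i) (p∈X i))

    ps∈f : ∀ i → ∃[ q ] q ∈ f × IsPair q (p i) (s i)
    ps∈f i = proj₁ (proj₂ (f-functional (p i) (p∈X i)))

    s-unique : ∀ i {v} → ∃[ q ] q ∈ f × IsPair q (p i) v → v ≡ s i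
    s-unique i {v} = proj₂ (proj₂ (f-functional (p i) (p∈X i))) v

    -- The equation replaces the elements of `u i` in `X` and keeps those in `A`. The mixed cases,
    -- an element of `p i` in `X` or some `p j` in `A`, contradict `X∩A=∅`.
    to : ∀ i z → z ∈ s i → (∃[ j ] N i j × z ≡ s j) ⊎ z ∈ p i
    to i z z∈s with proj₁ (f-equations (p i) (p∈X i) (u i) (s i) (pu∈S i , ps∈f i) z) z∈s
    ... | inj₁ (y , y∈u , y∈X , yz∈f) with proj₁ (∈u i y) y∈u
    ...   | inj₁ (j , Nij , refl) = inj₁ (j , Nij , s-unique j yz∈f)
    ...   | inj₂ y∈p              = ⊥-elim (X∩A=∅ y (y∈X , p⊆A y∈p))
    to i z z∈s | inj₂ (z∈u , z∈A) with proj₁ (∈u i z) z∈u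
    ...   | inj₁ (j , _ , refl) = ⊥-elim (X∩A=∅ z (p∈X j , z∈A))
    ...   | inj₂ z∈p            = inj₂ z∈p

    from : ∀ i z → (∃[ j ] N i j × z ≡ s j) ⊎ z ∈ p i → z ∈ s i
    from i z h = proj₂ (f-equations (p i) (p∈X i) (u i) (s i) (pu∈S i , ps∈f i) z) (rhs h)
      where
      rhs : _ → _
      rhs (inj₁ (j , Nij , refl)) =
        inj₁ (p j , proj₂ (∈u i (p j)) (inj₁ (j , Nij , refl)) , p∈X j , ps∈f j)
      rhs (inj₂ z∈p) = inj₂ (proj₂ (∈u i z) (inj₂ z∈p) , p⊆A z∈p)

    abstract
      decorate : ∃[ s ] IsDecoration p N s
      decorate = s , λ i z → to i z , from i z

  module Decoration {I : Set} {p : I → V} {N : I → I → Set} {s : I → V}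
                    (isLabel : ∀ i → IsLabel (p i)) (deco : IsDecoration p N s) where

    ∅∈s : ∀ i → ∅ ∈ s i
    ∅∈s i = proj₂ (deco i ∅) (inj₂ (proj₁ (isLabel i)))

    p⊆s : ∀ {i z} → z ∈ p i → z ∈ s i
    p⊆s {i} {z} = proj₂ (deco i z) ∘ inj₂

    N⇒∈ : ∀ {i j} → N i j → s j ∈ s i
    N⇒∈ {i} {j} Nij = proj₂ (deco i (s j)) (inj₁ (j , Nij , refl))

    s∉label : ∀ {i q} → IsLabel q → s i ∉ q
    s∉label {i} (_ , h) s∈q = proj₁ (h (s i) s∈q) (∅∈s i)

    -- The other elements of `s i` are sets `s j`, which lie in no label. As `q` may belong to
    -- another decoration, labels can be compared between decorations.
    ∈label⇒∈p : ∀ {i z q} → IsLabel q → z ∈ q → z ∈ s i → z ∈ p i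
    ∈label⇒∈p {i} {z} {q} isLabel-q z∈q z∈s with proj₁ (deco i z) z∈s
    ... | inj₁ (j , _ , refl) = ⊥-elim (s∉label isLabel-q z∈q)
    ... | inj₂ z∈p            = z∈p

    neighbour : ∀ {i y} → y ∈ s i → s i ∈ y → ∃[ j ] N i j × y ≡ s j
    neighbour {i} {y} y∈s s∈y with proj₁ (deco i y) y∈s
    ... | inj₁ h   = h
    ... | inj₂ y∈p = ⊥-elim (proj₂ (proj₂ (isLabel i) y y∈p) (s i) s∈y (∅∈s i))

    linked⇒∈range : ∀ {i y} → Linked D (s i) y → ∃[ j ] y ≡ s j
    linked⇒∈range = go refl
      where
      -- The starting point becomes a variable so that the walk can be matched; `neighbour` keeps
      -- each next vertex in the range.
      go : ∀ {i x y} → x ≡ s i → Linked D x y → ∃[ j ] y ≡ s j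
      go eq ε = _ , eq
      go refl ((x∈y , y∈x) ◅ rest) = go (proj₂ (proj₂ (neighbour y∈x x∈y))) rest

  -- Components of D isomorphic to a finite graph

  -- `P` and `f` are external, so separation and replacement do not apply. The set is built one
  -- element at a time, with excluded middle deciding each `P i`.
  image-Fin : ∀ n (P : Fin n → Set) (f : Fin n → V) →
              ∃[ a ] (∀ z → z ∈ a ⟺ (∃[ i ] P i × z ≡ f i))
  image-Fin zero    P f = ∅ , λ z → ⊥-elim ∘ ∉∅ , λ ()
  image-Fin (suc n) P f with image-Fin n (P ∘ suc) (f ∘ suc) | em {P zero}
  ... | a , h | no ¬P0 = a , λ z → to z , from z
    where
    to : ∀ z → z ∈ a → ∃[ i ] P i × z ≡ f i
    to z z∈a = let i , h′ = proj₁ (h z) z∈a in suc i , h′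

    from : ∀ z → (∃[ i ] P i × z ≡ f i) → z ∈ a
    from z (zero  , P0 , _) = ⊥-elim (¬P0 P0)
    from z (suc i , h′)     = proj₂ (h z) (i , h′)
  ... | a , h | yes P0 = ｛ f zero ｝ ∪ a , λ z → to z , from z
    where
    to : ∀ z → z ∈ ｛ f zero ｝ ∪ a → ∃[ i ] P i × z ≡ f i
    to z z∈ with proj₁ (∈-∪ z) z∈
    ... | inj₁ z∈f0 = zero , P0 , ∈-singleton z∈f0
    ... | inj₂ z∈a  = let i , h′ = proj₁ (h z) z∈a in suc i , h′

    from : ∀ z → (∃[ i ] P i × z ≡ f i) → z ∈ ｛ f zero ｝ ∪ a
    from z (zero  , _ , refl) = proj₂ (∈-∪ z) (inj₁ x∈｛x｝)
    from z (suc i , h′)       = proj₂ (∈-∪ z) (inj₂ (proj₂ (h z) (i , h′)))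

  image : ∀ {n} {I : Set} → I ↔ Fin n → (P : I → Set) (f : I → V) →
          ∃[ a ] (∀ z → z ∈ a ⟺ (∃[ i ] P i × z ≡ f i))
  image enum P f with image-Fin _ (P ∘ Inverse.from enum) (f ∘ Inverse.from enum)
  ... | a , h = a , λ z →
      (λ z∈a → let i , h′ = proj₁ (h z) z∈a in Inverse.from enum i , h′)
    , λ (i , h′) → proj₂ (h z)
        (Inverse.to enum i
        , subst (λ i → P i × z ≡ f i) (sym (Inverse.strictlyInverseʳ enum i)) h′)

  module FiniteGraph (Γ : LoopyGraph) {n} (enum : Vertex Γ ↔ Fin n) (conn : Connected Γ) where

    i₀ : Vertex Γ
    i₀ = proj₁ conn

    index : ℕ → Vertex Γ → ℕ
    index k i = toℕ (Inverse.to enum i) + k * n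

    index-injective : ∀ k l i j → index k i ≡ index l j → i ≡ j × k ≡ l
    index-injective k l i j eq with i+kn-injective _ _ k l eq
    ... | i≡j , k≡l = trans (sym (Inverse.strictlyInverseʳ enum i))
      (trans (cong (Inverse.from enum) i≡j) (Inverse.strictlyInverseʳ enum j)) , k≡l

    isLabel : ∀ k i → IsLabel (label (index k i))
    isLabel k i = label-isLabel (index k i)

    abstract
      decorateFinite : ∀ k → ∃[ s ] IsDecoration (label ∘ index k) (Adj Γ) s
      decorateFinite k = FlatSystem.decorate p (Adj Γ) u (proj₁ X) (proj₁ S) (isLabel k)
        (λ z → (λ z∈ → map₂ proj₂ (proj₁ (proj₂ X z) z∈))
             , (λ (i , eq) → proj₂ (proj₂ X z) (i , tt , eq)))
        ∈u
        -- Equal labels share their atom, which determines the index and hence the vertex.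
        (λ i j eq → cong u (proj₁ (index-injective k k i j (atom∈label⇒≡
          (subst (atom (index k i) ∈_) eq (atom∈label (index k i)))))))
        (λ q → (λ q∈ → map₂ (λ (_ , eq) → subst (λ q → IsPair q _ _) (sym eq) (isPair-⟨,⟩ _ _))
                         (proj₁ (proj₂ S q) q∈))
             , (λ (i , h) → proj₂ (proj₂ S q) (i , tt , ≡⟨,⟩ h)))
        where
        p : Vertex Γ → V
        p = label ∘ index k

        N : ∀ i → ∃[ a ] (∀ z → z ∈ a ⟺ (∃[ j ] Adj Γ i j × z ≡ p j))
        N i = image enum (Adj Γ i) p

        u : Vertex Γ → V
        u i = proj₁ (N i) ∪ p i

        ∈u : ∀ i z → z ∈ u i ⟺ ((∃[ j ] Adj Γ i j × z ≡ p j) ⊎ z ∈ p i)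
        ∈u i z = [ inj₁ ∘ proj₁ (proj₂ (N i) z) , inj₂ ]′ ∘ proj₁ (∈-∪ z)
               , proj₂ (∈-∪ z) ∘ [ inj₁ ∘ proj₂ (proj₂ (N i) z) , inj₂ ]′

        X : ∃[ a ] (∀ z → z ∈ a ⟺ (∃[ i ] ⊤ × z ≡ p i))
        X = image enum (λ _ → ⊤) p

        S : ∃[ a ] (∀ z → z ∈ a ⟺ (∃[ i ] ⊤ × z ≡ ⟨ p i , u i ⟩))
        S = image enum (λ _ → ⊤) (λ i → ⟨ p i , u i ⟩)

    s : ℕ → Vertex Γ → V
    s k = proj₁ (decorateFinite k)

    module Deco k = Decoration {Vertex Γ} {label ∘ index k} {Adj Γ} {s k}
      (isLabel k) (proj₂ (decorateFinite k))

    -- The atom of `label (index k i)` lies in the common set, hence in `label (index l j)`.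
    -- Allowing `k` and `l` to differ also separates the copies.
    s-injective : ∀ {k l i j} → s k i ≡ s l j → i ≡ j × k ≡ l
    s-injective {k} {l} {i} {j} eq = index-injective k l i j (atom∈label⇒≡
      (Deco.∈label⇒∈p l (isLabel k i) (atom∈label (index k i))
        (subst (atom (index k i) ∈_) eq (Deco.p⊆s k (atom∈label (index k i))))))

    adj⇒ : ∀ {k i j} → Adj Γ i j → Adj D (s k i) (s k j)
    adj⇒ {k} Aij = Deco.N⇒∈ k (LoopyGraph.sym Γ Aij) , Deco.N⇒∈ k Aij

    ⇒adj : ∀ {k i j} → Adj D (s k i) (s k j) → Adj Γ i j
    ⇒adj {k} {i} (i∈j , j∈i) with Deco.neighbour k j∈i i∈j
    ... | j′ , Aij′ , eq = subst (Adj Γ i) (sym (proj₁ (s-injective {k} {k} eq))) Aij′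

    component≅ : ∀ k → component D (s k i₀) ≅ Γ
    component≅ k = record
      { vertices = mk↔ₛ′ to from
          (λ i → proj₁ (s-injective {k} {k} (sym (s∘to (from i)))))
          (λ x → value-injective (sym (s∘to x)))
      ; edges = λ x y → mk⇔
          (λ a → ⇒adj {k} (subst₂ (Adj D) (s∘to x) (s∘to y) a))
          (λ a → subst₂ (Adj D) (sym (s∘to x)) (sym (s∘to y)) (adj⇒ {k} a))
      }
      where
      C : Set
      C = Vertex (component D (s k i₀))

      -- The proof that x lies in the component is irrelevant, so excluded
      -- middle has to recover the vertex.
      preimage : (x : C) → ∃[ i ] value x ≡ s k i
      preimage (x , [ l ]) with em {∃[ i ] x ≡ s k i}
      ... | yes h = h
      ... | no ¬h = ⊥-elim-irr (¬h (Deco.linked⇒∈range k l))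

      to : C → Vertex Γ
      to = proj₁ ∘ preimage

      s∘to : ∀ x → value x ≡ s k (to x)
      s∘to = proj₂ ∘ preimage

      from : Vertex Γ → C
      from i = s k i , [ gmap (s k) (adj⇒ {k}) (proj₂ conn i₀ i) ]

    infinitelyManyComponents : Infinite (ComponentsIsomorphicTo Γ D)
    infinitelyManyComponents = record
      { to        = λ k → s k i₀ , component≅ k
      ; cong      = λ { refl → ε }
      -- A walk between the base vertices puts `s l i₀` in the range of `s k`.
      ; injective = λ {k} {l} linked → let i , eq = Deco.linked⇒∈range k linked
                                       in sym (proj₂ (s-injective {l} {k} eq))
      }

  -- An infinite component

  labelsOfW : ∃[ X ] (∀ p → p ∈ X ⟺ (p ∈ 𝒫 (𝒫 (𝒫 W)) × IsLabel p))
  -- The first `∅` is the parameter, variable 1 of `φ`, through which `φ` refers to the empty set.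
  labelsOfW = zfa _ (sep {1} φ) ∅ (𝒫 (𝒫 (𝒫 W)))
    where
    φ : Formula 2
    φ = 1F ∈̇ 0F ∧̇ ∀∈ 0F (¬̇ (2F ∈̇ 0F) ∧̇ ∀∈ 0F (¬̇ (3F ∈̇ 0F)))

  completeSystem : ∀ X → ∃[ S ] (∀ q → q ∈ S ⟺ (∃[ p ] p ∈ X × IsPair q p (X ∪ p)))
  -- `X` serves both as the parameter in `X ∪ p` and as the domain of the replacement.
  completeSystem X with zfa _ (rep {1} φ) X X functional
    where
    -- y = ⟨x, X ∪ x⟩, where x, y, X are the variables 0, 1, 2
    φ : Formula 3
    φ = ∃̇ (∀̇ 0F ∈̇ 1F ⇔̇ (0F ∈̇ 4F ∨̇ 0F ∈̇ 2F)) ∧̇ 2F ≐⟨ 1F , 0F ⟩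

    functional = λ { x _ y y′ ((u , hu , h) , (u′ , hu′ , h′)) →
      isPair-unique h (subst (IsPair y′ x) (extensional λ z →
        proj₂ (hu z) ∘ proj₁ (hu′ z) , proj₂ (hu′ z) ∘ proj₁ (hu z)) h′) }
  ... | S , h = S , λ q →
      (λ q∈S → let p , p∈X , u , hu , hp = proj₁ (h q) q∈S in
         p , p∈X , subst (IsPair q p) (extensional λ z →
           proj₂ (∈-∪ z) ∘ proj₁ (hu z) , proj₂ (hu z) ∘ proj₁ (∈-∪ z)) hp)
    , λ (p , p∈X , hp) → proj₂ (h q) (p , p∈X , X ∪ p , ∈-∪ , hp)

  infiniteComponent : ∃[ x ] Infinite (setoid (Vertex (component D x)))
  infiniteComponent = s (vertex 0) , mk↣ {to = to} injective
    where
    X : V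
    X = proj₁ labelsOfW

    -- `X` may contain labels other than the sets `label m`. These only enlarge the component, which
    -- needs just an injection from `ℕ`.
    I : Set
    I = ∃[ p ] p ∈ X

    isLabel : (i : I) → IsLabel (proj₁ i)
    isLabel (p , p∈X) = proj₂ (proj₁ (proj₂ labelsOfW p) p∈X)

    vertex : ℕ → I
    vertex m = label m , proj₂ (proj₂ labelsOfW _) (label∈𝒫³W m , label-isLabel m)

    decoration : ∃[ s ] IsDecoration {I} proj₁ (λ _ _ → ⊤) s
    decoration = FlatSystem.decorate proj₁ (λ _ _ → ⊤) (λ i → X ∪ proj₁ i)
      X (proj₁ (completeSystem X)) isLabel
      (λ z → (λ z∈X → (z , z∈X) , refl) , λ { ((_ , p∈X) , refl) → p∈X })
      (λ i z → [ (λ z∈X → inj₁ ((z , z∈X) , tt , refl)) , inj₂ ]′ ∘ proj₁ (∈-∪ z)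
             , λ { (inj₁ ((_ , p∈X) , _ , refl)) → proj₂ (∈-∪ z) (inj₁ p∈X)
                 ; (inj₂ z∈p) → proj₂ (∈-∪ z) (inj₂ z∈p) })
      (λ i j → cong (X ∪_))
      (λ q → (λ q∈S → let p , p∈X , h = proj₁ (proj₂ (completeSystem X) q) q∈S
                      in (p , p∈X) , h)
           , λ { ((p , p∈X) , h) → proj₂ (proj₂ (completeSystem X) q) (p , p∈X , h) })

    s : I → V
    s = proj₁ decoration

    open Decoration isLabel (proj₂ decoration)

    to : ℕ → Vertex (component D (s (vertex 0)))
    -- In a complete graph with loops, one edge reaches every vertex.
    to m = s (vertex m) , [ (N⇒∈ tt , N⇒∈ tt) ◅ ε ]

    injective : ∀ {m n} → to m ≡ to n → m ≡ n
    injective {m} {n} eq = atom∈label⇒≡ {m} {n}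
      (∈label⇒∈p (label-isLabel m) (atom∈label m)
        (subst (atom m ∈_) (cong value eq) (p⊆s (atom∈label m))))

theorem4 : ExcludedMiddle 0ℓ →
    (M : Structure) → Countable M → M ⊨ᵀ ZFA →
    ((Γ : LoopyGraph) → Finite Γ → Connected Γ →
    Infinite (ComponentsIsomorphicTo Γ (doubleEdgeGraph M)))
    × (∃[ x ] Infinite (setoid (Vertex (component (doubleEdgeGraph M) x))))
theorem4 em M _ zfa =
    (λ Γ (n , enum) → FiniteGraph.infinitelyManyComponents Γ enum)
  , infiniteComponent
  where open Model em M zfa
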